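{- Let $R$ be a set of $n$ real numbers, given in non-decreasing order, and let $k$ be a positive integer. The modified version of Algorithm 2 that works without storing the bit-pattern (defined in the context) runs on input $(R,k)$ in $O(k\log_2 k)$ time.
   Context: The numbers of $R$ are given sorted as $R[1]\le\dots\le R[n]$ (sorting time is not counted). A nonempty subset $S\subseteq R$ corresponds to the bit-pattern $B[1\ldots n]$ with $B[i]=1$ iff $R[i]\in S$; its value is $F(S)=\sum_{r\in S}r$. The goal is to generate the $k$ nonempty subsets with smallest values, in order of value, ties broken arbitrarily. Node record for $S$ in the modified algorithm (the bit-pattern itself is not stored): the size $ls=|S|$, the value $F(S)$, and four pointers: $p_1$, the position of the first 1 appearing after the first block of 0s in $B$ ($p_1=0$ if there is none); $p_2$, the position of the rightmost 1 of the first contiguous block of 1s if $B[1]=1$, and $p_2=0$ otherwise; $p_3$, the position of the rightmost 1 in $B$; and one extra pointer giving the position of the first 1 after position $p_1$ (if any). Children of a node (at most two in total), each record being created from the parent's record with value and pointers updated accordingly: (a) if $1<p_1<n$ and $B[p_1+1]=0$ (i.e. the extra pointer is not $p_1+1$), the child whose bit-pattern is obtained by swapping $B[p_1]$ and $B[p_1+1]$; (b) if $0<p_2<n$, the child whose bit-pattern is obtained by swapping $B[p_2]$ and $B[p_2+1]$; (c) if $(p_1,p_2,p_3)=(2,0,ls+1)$, the child whose bit-pattern is obtained by setting $B[1]=1$. Modified Algorithm 2: create the root record, for the subset $\{R[1]\}$ ($p_1=0$, $p_2=p_3=1$, size $1$, value $R[1]$), and insert it in a min-max-heap $H$ keyed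 by value. For $q=1,\dots,k$: extract the node of minimum value from $H$, output it with its value as the $q$-th best subset, create its children by rules (a), (b), (c) and insert them in $H$; then, if the number of elements in $H$ exceeds $k-q$, remove the element of maximum value from $H$. The elements of each generated subset are obtained incrementally: the subset of a child is specified by the $O(1)$ changes to the indices of the elements of its parent's subset. Arithmetic operations and comparisons of real numbers take unit time. -}

module Defs where

open import Level using (0ℓ)
open import Algebra.Bundles using (CommutativeMonoid)
open import Algebra.Structures using (IsCommutativeRing)
open import Data.Bool using (Bool; true; false; T; if_then_else_; not; _∧_)
open import Data.Fin as Fin using (Fin; fromℕ<)
open import Data.List using (List; []; _∷_)
open import Data.Maybe using (Maybe; just; nothing)
open import Data.Nat
open import Data.Nat.Properties
open import Data.Product using (∃; _×_; _,_; proj₁; proj₂)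
open import Data.Unit using (⊤; tt)
open import Data.Vec.Functional using (Vector)
open import Function using (_∘_)
open import Relation.Binary.Core using (Rel)
open import Relation.Binary.PropositionalEquality
open import Relation.Binary.Structures using (IsDecTotalOrder)
open import Relation.Nullary using (¬_; yes; no; contradiction)
open import Relation.Nullary.Decidable using (⌊_⌋)

------------------------------------------------------------------------
-- The real numbers, axiomatised as a complete ordered field. The order is
-- decidable because the algorithm compares reals in one step.

record RealField : Set₁ where
  infix  4 _≈_ _≤ᴿ_
  infixl 6 _+ᴿ_ _-ᴿ_
  infixl 7 _*ᴿ_
  field
    Carrier           : Set
    _≈_ _≤ᴿ_          : Rel Carrier 0ℓ
    _+ᴿ_ _*ᴿ_         : Carrier → Carrier → Carrier
    -ᴿ_               : Carrier → Carrier
    0ᴿ 1ᴿ             : Carrier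
    isCommutativeRing : IsCommutativeRing _≈_ _+ᴿ_ _*ᴿ_ -ᴿ_ 0ᴿ 1ᴿ
    0≉1               : ¬ 0ᴿ ≈ 1ᴿ
    inverse           : ∀ x → ¬ x ≈ 0ᴿ → ∃ λ y → x *ᴿ y ≈ 1ᴿ
    isDecTotalOrder   : IsDecTotalOrder _≈_ _≤ᴿ_
    +-mono            : ∀ x y z → x ≤ᴿ y → x +ᴿ z ≤ᴿ y +ᴿ z
    *-nonneg          : ∀ x y → 0ᴿ ≤ᴿ x → 0ᴿ ≤ᴿ y → 0ᴿ ≤ᴿ x *ᴿ y

  UpperBound : (Carrier → Set) → Carrier → Set
  UpperBound P b = ∀ x → P x → x ≤ᴿ b

  field
    supremum : (P : Carrier → Set) → ∃ P → ∃ (UpperBound P) →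
               ∃ λ s → UpperBound P s × (∀ b → UpperBound P b → s ≤ᴿ b)

  _-ᴿ_ : Carrier → Carrier → Carrier
  x -ᴿ y = x +ᴿ (-ᴿ y)

  open IsDecTotalOrder isDecTotalOrder public using () renaming (_≤?_ to _≤ᴿ?_)

Sorted : (𝓡 : RealField) {n : ℕ} → Vector (RealField.Carrier 𝓡) n → Set
Sorted 𝓡 R = ∀ i j → i Fin.≤ j → RealField._≤ᴿ_ 𝓡 (R i) (R j)

-- Positions are numbered from 1; position 0 plays the role of "none".

module Algorithm (𝓡 : RealField) {n : ℕ} (R : Vector (RealField.Carrier 𝓡) n) where
  open RealField 𝓡

  -- R[i]; the value 0 outside 1..n is never used by the algorithm.
  R[_] : ℕ → Carrier
  R[ zero ] = 0ᴿ
  R[ suc i ] with i <? n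
  ... | yes i<n = R (fromℕ< i<n)
  ... | no  _   = 0ᴿ

  record Node : Set where
    constructor node
    field
      ls    : ℕ
      F     : Carrier
      p₁    : ℕ
      p₂    : ℕ
      p₃    : ℕ
      extra : ℕ        -- 0 if there is no 1 after position p₁, or if p₁ = 0

  -- How a subset is obtained from the subset of its parent: the index p is
  -- replaced by p + 1, or the index 1 is added.
  data Change : Set where
    shift  : (p : ℕ) → Change
    addOne : Change

  -- A subset is given by the output number of its parent and the change;
  -- the root {R[1]} has no parent.
  Origin : Set
  Origin = Maybe (ℕ × Change)

  Entry : Set
  Entry = Node × Origin

  Output : Set
  Output = Carrier × Origin

  ----------------------------------------------------------------------
  -- The machine: a unit-cost RAM. Integer registers, real registers and
  -- entries are Agda variables; the rest of its store is the array of the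
  -- heap (cells 1..size) and a write-only output tape, latest item first.

  record Memory : Set where
    constructor memory
    field
      size : ℕ
      cell : ℕ → Entry
      tape : List Output

  open Memory

  data Instr : Set → Set₁ where
    addℕ subℕ mulℕ : ℕ → ℕ → Instr ℕ
    halfℕ          : ℕ → Instr ℕ
    leqℕ eqℕ       : ℕ → ℕ → Instr Bool
    fetchR         : ℕ → Instr Carrier
    addR subR      : Carrier → Carrier → Instr Carrier
    leqR           : Carrier → Carrier → Instr Bool
    getSize        : Instr ℕ
    setSize        : ℕ → Instr ⊤
    readCell       : ℕ → Instr Entry
    writeCell      : ℕ → Entry → Instr ⊤
    emit           : Output → Instr ⊤

  exec : ∀ {A} → Instr A → Memory → A × Memory
  exec (addℕ i j)      m = i + j , m
  exec (subℕ i j)      m = i ∸ j , m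
  exec (mulℕ i j)      m = i * j , m
  exec (halfℕ i)       m = ⌊ i /2⌋ , m
  exec (leqℕ i j)      m = (i ≤ᵇ j) , m
  exec (eqℕ i j)       m = (i ≡ᵇ j) , m
  exec (fetchR i)      m = R[ i ] , m
  exec (addR x y)      m = x +ᴿ y , m
  exec (subR x y)      m = x -ᴿ y , m
  exec (leqR x y)      m = ⌊ x ≤ᴿ? y ⌋ , m
  exec getSize         m = size m , m
  exec (setSize s)     m = tt , record m { size = s }
  exec (readCell i)    m = cell m i , m
  exec (writeCell i e) m =
    tt , record m { cell = λ j → if j ≡ᵇ i then e else cell m j }
  exec (emit o)        m = tt , record m { tape = o ∷ tape m }

  infixl 1 _>>=_ _>>_

  data Prog : Set → Set₁ where
    return : ∀ {A} → A → Prog A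
    ⟪_⟫    : ∀ {A} → Instr A → Prog A
    _>>=_  : ∀ {A B} → Prog A → (A → Prog B) → Prog B

  _>>_ : ∀ {A B} → Prog A → Prog B → Prog B
  p >> q = p >>= λ _ → q

  skip : Prog ⊤
  skip = return tt

  run : ∀ {A} → Prog A → Memory → A × Memory
  run (return a) m = a , m
  run ⟪ i ⟫      m = exec i m
  run (p >>= f)  m = let (a , m′) = run p m in run (f a) m′

  -- The number of instructions executed.
  time : ∀ {A} → Prog A → Memory → ℕ
  time (return a) m = 0
  time ⟪ i ⟫      m = 1
  time (p >>= f)  m = let (a , m′) = run p m in time p m + time (f a) m′

  ----------------------------------------------------------------------
  -- Min-max heap (Atkinson, Sack, Santoro, Strothotte) in the cells
  -- 1..size: the children of cell i are the cells 2i and 2i+1, and levels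
  -- are alternately min levels and max levels, the root being on a min
  -- level. The arguments called fuel only justify termination: their
  -- initial values suffice for every run, since the indices at least halve
  -- or double in each step.

  data Order : Set where
    min max : Order

  opposite : Order → Order
  opposite min = max
  opposite max = min

  -- Strict comparison of keys: smaller for min, larger for max.
  before : Order → ℕ → ℕ → Prog Bool
  before min i j = do
    (x , _) ← ⟪ readCell i ⟫
    (y , _) ← ⟪ readCell j ⟫
    y≤x ← ⟪ leqR (Node.F y) (Node.F x) ⟫
    return (not y≤x)
  before max i j = before min j i

  swapCells : ℕ → ℕ → Prog ⊤
  swapCells i j = do
    x ← ⟪ readCell i ⟫
    y ← ⟪ readCell j ⟫
    ⟪ writeCell i y ⟫
    ⟪ writeCell j x ⟫

  levelOrder : (fuel : ℕ) → ℕ → Prog Order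
  levelOrder zero    i = return min
  levelOrder (suc f) i = do
    isRoot ← ⟪ leqℕ i 1 ⟫
    if isRoot then return min else do
      parent ← ⟪ halfℕ i ⟫
      o ← levelOrder f parent
      return (opposite o)

  bubbleUpGrand : Order → (fuel : ℕ) → ℕ → Prog ⊤
  bubbleUpGrand o zero    i = skip
  bubbleUpGrand o (suc f) i = do
    hasGrandparent ← ⟪ leqℕ 4 i ⟫
    if not hasGrandparent then skip else do
      parent ← ⟪ halfℕ i ⟫
      grandparent ← ⟪ halfℕ parent ⟫
      b ← before o i grandparent
      if not b then skip else do
        swapCells i grandparent
        bubbleUpGrand o f grandparent

  bubbleUp : ℕ → Prog ⊤
  bubbleUp i = do
    o ← levelOrder i i
    hasParent ← ⟪ leqℕ 2 i ⟫
    if not hasParent then skip else do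
      parent ← ⟪ halfℕ i ⟫
      b ← before o parent i
      if b
        then (do swapCells i parent
                 bubbleUpGrand (opposite o) i parent)
        else bubbleUpGrand o i i

  -- The better of cells i and j, where j may lie outside the heap.
  better : Order → ℕ → ℕ → Prog ℕ
  better o i j = do
    s ← ⟪ getSize ⟫
    exists ← ⟪ leqℕ j s ⟫
    if not exists then return i else do
      b ← before o j i
      return (if b then j else i)

  bestDescendant : Order → ℕ → Prog ℕ
  bestDescendant o i = do
    c₀ ← ⟪ mulℕ 2 i ⟫
    c₁ ← ⟪ addℕ c₀ 1 ⟫
    g₀ ← ⟪ mulℕ 4 i ⟫
    g₁ ← ⟪ addℕ g₀ 1 ⟫
    g₂ ← ⟪ addℕ g₀ 2 ⟫
    g₃ ← ⟪ addℕ g₀ 3 ⟫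
    m ← better o c₀ c₁
    m ← better o m g₀
    m ← better o m g₁
    m ← better o m g₂
    better o m g₃

  trickleDown : Order → (fuel : ℕ) → ℕ → Prog ⊤
  trickleDown o zero    i = skip
  trickleDown o (suc f) i = do
    s ← ⟪ getSize ⟫
    c ← ⟪ mulℕ 2 i ⟫
    hasChild ← ⟪ leqℕ c s ⟫
    if not hasChild then skip else do
      m ← bestDescendant o i
      b ← before o m i
      if not b then skip else do
        swapCells i m
        g ← ⟪ mulℕ 4 i ⟫
        isGrandchild ← ⟪ leqℕ g m ⟫
        if not isGrandchild then skip else do
          parent ← ⟪ halfℕ m ⟫
          b′ ← before o parent m
          if b′ then swapCells m parent else skip
          trickleDown o f m

  insert : Entry → Prog ⊤
  insert e = do
    s ← ⟪ getSize ⟫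
    i ← ⟪ addℕ s 1 ⟫
    ⟪ setSize i ⟫
    ⟪ writeCell i e ⟫
    bubbleUp i

  -- Remove cell i of a nonempty heap, where o is the order of its level.
  removeAt : Order → ℕ → Prog Entry
  removeAt o i = do
    s ← ⟪ getSize ⟫
    e ← ⟪ readCell i ⟫
    final ← ⟪ readCell s ⟫
    ⟪ writeCell i final ⟫
    s′ ← ⟪ subℕ s 1 ⟫
    ⟪ setSize s′ ⟫
    trickleDown o s′ i
    return e

  extractMin : Prog Entry
  extractMin = removeAt min 1

  removeMax : Prog Entry
  removeMax = do
    s ← ⟪ getSize ⟫
    single ← ⟪ leqℕ s 1 ⟫
    if single then removeAt min 1 else do
      i ← better max 2 3
      removeAt max i

  ----------------------------------------------------------------------
  -- In terms of the bit-pattern B: childA swaps B[p₁] = 1 and B[p₁+1] = 0,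
  -- childB swaps B[p₂] = 1 and B[p₂+1] = 0, childC sets B[1] = 1 when the
  -- 1s of B are exactly at 2, …, ls+1. The conditions are tested by tryA,
  -- tryB and tryC; the new pointers are proved right in `sound` below.

  -- p₃ after the swap of B[p] = 1 and B[p+1] = 0.
  moveLast : (p q p₃ : ℕ) → Prog ℕ
  moveLast p q p₃ = do
    isLast ← ⟪ eqℕ p₃ p ⟫
    return (if isLast then q else p₃)

  moveValue : (p q : ℕ) → Carrier → Prog Carrier
  moveValue p q v = do
    x ← ⟪ fetchR p ⟫
    y ← ⟪ fetchR q ⟫
    w ← ⟪ subR v x ⟫
    ⟪ addR w y ⟫

  childA childB childC : Node → Prog Node
  childA (node ls v p₁ p₂ p₃ e) = do
    q ← ⟪ addℕ p₁ 1 ⟫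
    v′ ← moveValue p₁ q v
    p₃′ ← moveLast p₁ q p₃
    return (node ls v′ q p₂ p₃′ e)
  childB (node ls v p₁ p₂ p₃ e) = do
    q ← ⟪ addℕ p₂ 1 ⟫
    v′ ← moveValue p₂ q v
    p₃′ ← moveLast p₂ q p₃
    p₂′ ← ⟪ subℕ p₂ 1 ⟫
    return (node ls v′ q p₂′ p₃′ p₁)
  childC (node ls v p₁ p₂ p₃ e) = do
    x ← ⟪ fetchR 1 ⟫
    v′ ← ⟪ addR v x ⟫
    ls′ ← ⟪ addℕ ls 1 ⟫
    return (node ls′ v′ 0 p₃ p₃ 0)

  -- q is the output number of the parent.
  tryA tryB tryC : (q : ℕ) → Node → Prog ⊤
  tryA q r = do
    let open Node r
    1<p₁ ← ⟪ leqℕ 2 p₁ ⟫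
    s ← ⟪ addℕ p₁ 1 ⟫
    p₁<n ← ⟪ leqℕ s n ⟫
    next ← ⟪ eqℕ extra s ⟫
    if 1<p₁ ∧ p₁<n ∧ not next
      then (do r′ ← childA r
               insert (r′ , just (q , shift p₁)))
      else skip
  tryB q r = do
    let open Node r
    0<p₂ ← ⟪ leqℕ 1 p₂ ⟫
    s ← ⟪ addℕ p₂ 1 ⟫
    p₂<n ← ⟪ leqℕ s n ⟫
    if 0<p₂ ∧ p₂<n
      then (do r′ ← childB r
               insert (r′ , just (q , shift p₂)))
      else skip
  tryC q r = do
    let open Node r
    t₁ ← ⟪ eqℕ p₁ 2 ⟫
    t₂ ← ⟪ eqℕ p₂ 0 ⟫
    s ← ⟪ addℕ ls 1 ⟫
    t₃ ← ⟪ eqℕ p₃ s ⟫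
    if t₁ ∧ t₂ ∧ t₃
      then (do r′ ← childC r
               insert (r′ , just (q , addOne)))
      else skip

  ----------------------------------------------------------------------
  -- Iterations q, q + 1, …, k, where steps = k + 1 - q. If k exceeds the
  -- number of nonempty subsets, H becomes empty and the algorithm stops.
  loop : (steps q k : ℕ) → Prog ⊤
  loop zero    q k = skip
  loop (suc t) q k = do
    s ← ⟪ getSize ⟫
    empty ← ⟪ eqℕ s 0 ⟫
    if empty then skip else do
      (r , origin) ← extractMin
      ⟪ emit (Node.F r , origin) ⟫
      tryA q r
      tryB q r
      tryC q r
      s′ ← ⟪ getSize ⟫
      remaining ← ⟪ subℕ k q ⟫
      fits ← ⟪ leqℕ s′ remaining ⟫
      if fits then skip else (do
        _ ← removeMax
        skip)
      q′ ← ⟪ addℕ q 1 ⟫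
      loop t q′ k

  modifiedAlgorithm2 : (k : ℕ) → Prog ⊤
  modifiedAlgorithm2 k = do
    x ← ⟪ fetchR 1 ⟫
    insert (node 1 x 0 1 1 0 , nothing)
    loop k 1 k

  -- The cells of an empty heap have arbitrary contents, which are not read.
  initial : Memory
  initial = memory 0 (λ _ → node 0 0ᴿ 0 0 0 0 , nothing) []

  runningTime : (k : ℕ) → ℕ
  runningTime k = time (modifiedAlgorithm2 k) initial

  ----------------------------------------------------------------------
  -- Specification of the records: what it means for a record to describe
  -- a bit-pattern. The program never uses bit-patterns. A pattern is 0
  -- outside the positions 1..n.

  Pattern : Set
  Pattern = ℕ → Bool

  One Zero : Pattern → ℕ → Set
  One  B i = B i ≡ true
  Zero B i = B i ≡ false

  swapNext : ℕ → Pattern → Pattern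
  swapNext p B i with i ≟ p | i ≟ suc p
  ... | yes _ | _     = B (suc p)
  ... | no _  | yes _ = B p
  ... | no _  | no _  = B i

  setFirst : Pattern → Pattern
  setFirst B i with i ≟ 1
  ... | yes _ = true
  ... | no _  = B i

  -- The sum of the weights of the positions i ≤ m with B[i] = 1.
  module WeightedSum (M : CommutativeMonoid 0ℓ 0ℓ)
                     (w : ℕ → CommutativeMonoid.Carrier M) where
    open CommutativeMonoid M using (_∙_; ε) renaming (Carrier to C)

    total : Pattern → ℕ → C
    total B zero    = ε
    total B (suc m) = if B (suc m) then total B m ∙ w (suc m) else total B m

  +ᴿ-commutativeMonoid : CommutativeMonoid 0ℓ 0ℓ
  +ᴿ-commutativeMonoid = record
    { isCommutativeMonoid = IsCommutativeRing.+-isCommutativeMonoid isCommutativeRing }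

  open WeightedSum +-0-commutativeMonoid (λ _ → 1) using () renaming (total to count)
  open WeightedSum +ᴿ-commutativeMonoid R[_] using () renaming (total to sum)

  -- p is the least number satisfying P, or 0 if there is none.
  data First (P : ℕ → Set) : ℕ → Set where
    none  : (∀ i → ¬ P i) → First P 0
    found : ∀ {p} → P p → (∀ i → i < p → ¬ P i) → First P p

  -- The first 1 after the first block of 0s is the first 1 that has a 0
  -- somewhere before it.
  AfterZero : Pattern → ℕ → Set
  AfterZero B i = One B i × ∃ λ z → 1 ≤ z × z < i × Zero B z

  record Describes (B : Pattern) (r : Node) : Set where
    constructor describes
    open Node r
    field
      support    : ∀ i → One B i → 1 ≤ i × i ≤ n
      size-ok    : ls ≡ count B n
      value-ok   : F ≈ sum B n
      p₁-ok      : First (AfterZero B) p₁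
      p₂-ones    : ∀ i → 1 ≤ i → i ≤ p₂ → One B i
      p₂-end     : Zero B (suc p₂)
      p₃-one     : One B p₃
      p₃-last    : ∀ i → p₃ < i → Zero B i
      extra-ok   : 1 ≤ p₁ → First (λ i → p₁ < i × One B i) extra

  result : ∀ {A} → Memory → Prog A → A
  result m p = proj₁ (run p m)

  Sound : Set
  Sound = ∀ m B r → Describes B r → let open Node r in
    (1 < p₁ → p₁ < n → extra ≢ suc p₁ → Describes (swapNext p₁ B) (result m (childA r)))
    × (0 < p₂ → p₂ < n → Describes (swapNext p₂ B) (result m (childB r)))
    × (p₁ ≡ 2 → p₂ ≡ 0 → p₃ ≡ suc ls → Describes (setFirst B) (result m (childC r)))

  private
    clash : ∀ {b} {A : Set} → b ≡ true → b ≡ false → A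
    clash refl ()

    module AddBit (M : CommutativeMonoid 0ℓ 0ℓ)
                  (w : ℕ → CommutativeMonoid.Carrier M) where
      open CommutativeMonoid M using (_∙_; ε; comm; assoc; ∙-cong; ∙-congˡ; ∙-congʳ) 
        renaming (_≈_ to _~_; refl to ~refl; sym to ~sym; trans to ~trans)
      open WeightedSum M w

      total-cong : ∀ B C m → (∀ i → i ≤ m → B i ≡ C i) → total B m ≡ total C m
      total-cong B C zero    e = refl
      total-cong B C (suc m) e
        rewrite e (suc m) ≤-refl
              | total-cong B C m (λ i i≤m → e i (m≤n⇒m≤1+n i≤m)) = refl

      total-add : ∀ B C p m → 1 ≤ p → p ≤ m → Zero B p → One C p →
                  (∀ i → i ≢ p → B i ≡ C i) → total C m ~ (total B m ∙ w p)
      total-add B C p zero    1≤p p≤m b c e = contradiction (≤-trans 1≤p p≤m) λ ()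
      total-add B C p (suc m) 1≤p p≤m b c e with p ≟ suc m
      ... | yes refl rewrite b | c | total-cong B C m (λ i i≤m → e i (<⇒≢ (s≤s i≤m))) = ~refl
      ... | no p≢ with total-add B C p m 1≤p (s≤s⁻¹ (≤∧≢⇒< p≤m p≢)) b c e
      ...   | ih rewrite e (suc m) (p≢ ∘ sym) with C (suc m)
      ...     | true  = ~trans (∙-congʳ ih) (~trans (assoc _ _ _) (~trans (∙-congˡ (comm _ _)) (~sym (assoc _ _ _))))
      ...     | false = ih

      total-empty : ∀ m → total (λ _ → false) m ≡ ε
      total-empty zero    = refl
      total-empty (suc m) = total-empty m

    clear : ℕ → Pattern → Pattern
    clear p B i with i ≟ p
    ... | yes _ = false
    ... | no _  = B i

    clear-at : ∀ p B → Zero (clear p B) p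
    clear-at p B with p ≟ p
    ... | yes _ = refl
    ... | no ¬e = contradiction refl ¬e

    clear-else : ∀ p B i → i ≢ p → clear p B i ≡ B i
    clear-else p B i i≢p with i ≟ p
    ... | yes e = contradiction e i≢p
    ... | no _  = refl

    swap-at : ∀ p B → swapNext p B p ≡ B (suc p)
    swap-at p B with p ≟ p | p ≟ suc p
    ... | yes _ | _ = refl
    ... | no ¬e | _ = contradiction refl ¬e

    swap-next : ∀ p B → swapNext p B (suc p) ≡ B p
    swap-next p B with suc p ≟ p | suc p ≟ suc p
    ... | yes e | _     = contradiction e (1+n≢n)
    ... | no _  | yes _ = refl
    ... | no _  | no ¬e = contradiction refl ¬e

    swap-else : ∀ p B i → i ≢ p → i ≢ suc p → swapNext p B i ≡ B i
    swap-else p B i i≢p i≢q with i ≟ p | i ≟ suc p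
    ... | yes e | _     = contradiction e i≢p
    ... | no _  | yes e = contradiction e i≢q
    ... | no _  | no _  = refl

    swap-below : ∀ p B i → i < p → swapNext p B i ≡ B i
    swap-below p B i i<p = swap-else p B i (<⇒≢ i<p) (<⇒≢ (m<n⇒m<1+n i<p))

    swap-above : ∀ p B i → suc p < i → swapNext p B i ≡ B i
    swap-above p B i q<i = swap-else p B i (>⇒≢ (<-trans (n<1+n p) q<i)) (>⇒≢ q<i)

    set-at : ∀ B → One (setFirst B) 1
    set-at B = refl

    set-else : ∀ B i → i ≢ 1 → setFirst B i ≡ B i
    set-else B i i≢1 with i ≟ 1
    ... | yes e = contradiction e i≢1
    ... | no _  = refl

    First-map : ∀ {P Q : ℕ → Set} {p} → (∀ i → P i → Q i) → (∀ i → Q i → P i) →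
                First P p → First Q p
    First-map f g (none h)    = none λ i q → h i (g i q)
    First-map f g (found x h) = found (f _ x) λ i i<p q → h i i<p (g i q)

    count-≤ : ∀ B d i m → i ≤ m → d + count B i ≤ i → d + count B m ≤ m
    count-≤ B d i zero    z≤n h = h
    count-≤ B d i (suc m) i≤m h with i ≟ suc m
    ... | yes refl = h
    ... | no i≢ with count-≤ B d i m (s≤s⁻¹ (≤∧≢⇒< i≤m i≢)) h | B (suc m)
    ...   | ih | false = m≤n⇒m≤1+n ih
    ...   | ih | true rewrite +-comm (count B m) 1 | +-suc d (count B m) = s≤s ih

    count-zero : ∀ B d i → d + count B i ≤ i → Zero B (suc i) →
                 suc d + count B (suc i) ≤ suc i
    count-zero B d i h b rewrite b = s≤s h

    count-tail : ∀ B p m → p ≤ m → (∀ i → p < i → Zero B i) → count B m ≡ count B p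
    count-tail B p zero    z≤n h = refl
    count-tail B p (suc m) p≤m h with p ≟ suc m
    ... | yes refl = refl
    ... | no p≢ rewrite h (suc m) (≤∧≢⇒< p≤m p≢) =
      count-tail B p m (s≤s⁻¹ (≤∧≢⇒< p≤m p≢)) h

    module Swap {B : Pattern} {r : Node} (D : Describes B r) (p : ℕ)
                (0<p : 0 < p) (p<n : p < n) (b : One B p) (c : Zero B (suc p)) where
      open Node r
      open Describes D
      open IsCommutativeRing isCommutativeRing using (+-congʳ; +-congˡ; -‿inverseʳ)
        renaming (+-assoc to +ᴿ-assoc; +-identityʳ to +ᴿ-identityʳ; sym to ≈sym; trans to ≈trans)

      B′ B₀ : Pattern
      B′ = swapNext p B
      B₀ = clear p B

      at-p : Zero B′ p
      at-p = trans (swap-at p B) c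

      at-q : One B′ (suc p)
      at-q = trans (swap-next p B) b

      support′ : ∀ i → One B′ i → 1 ≤ i × i ≤ n
      support′ i o with i ≟ p | i ≟ suc p
      ... | yes refl | _        = clash o c
      ... | no _     | yes refl = s≤s z≤n , p<n
      ... | no _     | no _     = support i o

      agree : ∀ i → i ≢ suc p → B₀ i ≡ B′ i
      agree i i≢q with i ≟ p
      ... | yes refl = sym c
      ... | no i≢p with i ≟ suc p
      ...   | yes e = contradiction e i≢q
      ...   | no _  = refl

      at-q₀ : Zero B₀ (suc p)
      at-q₀ = trans (clear-else p B (suc p) 1+n≢n) c

      size′ : ls ≡ count B′ n
      size′ = trans size-ok (trans
        (total-add B₀ B p n 0<p (<⇒≤ p<n) (clear-at p B) b (clear-else p B))
        (sym (total-add B₀ B′ (suc p) n (s≤s z≤n) p<n at-q₀ at-q agree)))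
        where open AddBit +-0-commutativeMonoid (λ _ → 1)

      value′ : F -ᴿ R[ p ] +ᴿ R[ suc p ] ≈ sum B′ n
      value′ = ≈trans (+-congʳ
        (≈trans (+-congʳ (≈trans value-ok
          (total-add B₀ B p n 0<p (<⇒≤ p<n) (clear-at p B) b (clear-else p B))))
        (≈trans (+ᴿ-assoc _ _ _) (≈trans (+-congˡ (-‿inverseʳ _)) (+ᴿ-identityʳ _)))))
        (≈sym (total-add B₀ B′ (suc p) n (s≤s z≤n) p<n at-q₀ at-q agree))
        where open AddBit +ᴿ-commutativeMonoid R[_]

      p₃′ : ℕ
      p₃′ = if p₃ ≡ᵇ p then suc p else p₃

      last′ : One B′ p₃′ × (∀ i → p₃′ < i → Zero B′ i)
      last′ with p₃ ≡ᵇ p | ≡ᵇ⇒≡ p₃ p | ≡⇒≡ᵇ p₃ p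
      ... | true | f | _ with refl ← f tt =
        at-q , λ i q<i → trans (swap-above p B i q<i) (p₃-last i (<-trans (n<1+n p) q<i))
      ... | false | _ | g =
        trans (swap-above p B p₃ q<p₃) p₃-one ,
        λ i l → trans (swap-above p B i (<-trans q<p₃ l)) (p₃-last i l)
        where
        p≤p₃ : p ≤ p₃
        p≤p₃ = ≮⇒≥ λ l → clash b (p₃-last p l)
        q<p₃ : suc p < p₃
        q<p₃ = ≤∧≢⇒< (≤∧≢⇒< p≤p₃ (g ∘ sym)) λ { refl → clash p₃-one c }

  root-sound : 1 ≤ n → Describes (_≡ᵇ 1) (node 1 R[ 1 ] 0 1 1 0)
  root-sound 1≤n = describes support′ size′ value′
    (none no-first) ones′ refl refl last′ λ ()
    where
    open IsCommutativeRing isCommutativeRing using (+-congʳ)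
      renaming (+-identityˡ to +ᴿ-identityˡ; reflexive to ≈reflexive; sym to ≈sym; trans to ≈trans)

    only : ∀ i → One (_≡ᵇ 1) i → i ≡ 1
    only i o = ≡ᵇ⇒≡ i 1 (subst T (sym o) tt)

    other : ∀ i → i ≢ 1 → false ≡ (i ≡ᵇ 1)
    other i i≢1 with i ≡ᵇ 1 in eq
    ... | true  = contradiction (only i eq) i≢1
    ... | false = refl

    support′ : ∀ i → One (_≡ᵇ 1) i → 1 ≤ i × i ≤ n
    support′ i o with refl ← only i o = ≤-refl , 1≤n

    no-first : ∀ i → ¬ AfterZero (_≡ᵇ 1) i
    no-first i (o , y , 1≤y , y<i , _) with refl ← only i o = contradiction 1≤y (<⇒≱ y<i)

    ones′ : ∀ i → 1 ≤ i → i ≤ 1 → One (_≡ᵇ 1) i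
    ones′ i 1≤i i≤1 with refl ← ≤-antisym i≤1 1≤i = refl

    last′ : ∀ i → 1 < i → Zero (_≡ᵇ 1) i
    last′ i 1<i = sym (other i (>⇒≢ 1<i))

    size′ : 1 ≡ count (_≡ᵇ 1) n
    size′ = sym (trans (total-add (λ _ → false) _ 1 n ≤-refl 1≤n refl refl other)
                       (cong (_+ 1) (total-empty n)))
      where open AddBit +-0-commutativeMonoid (λ _ → 1)

    value′ : R[ 1 ] ≈ sum (_≡ᵇ 1) n
    value′ = ≈sym (≈trans (total-add (λ _ → false) _ 1 n ≤-refl 1≤n refl refl other)
                  (≈trans (+-congʳ (≈reflexive (total-empty n))) (+ᴿ-identityˡ _)))
      where open AddBit +ᴿ-commutativeMonoid R[_]

  sound : Sound
  sound m B r@(node ls v p₁ p₂ p₃ e) D = ruleA , ruleB , ruleC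
    where
    open Describes D

    ruleA : 1 < p₁ → p₁ < n → e ≢ suc p₁ → Describes (swapNext p₁ B) (result m (childA r))
    ruleA 1<p p<n e≢q rewrite +-comm p₁ 1 with p₁-ok
    ... | none _ = contradiction 1<p λ ()
    ... | found (b , z , 1≤z , z<p , zero-z) least =
      describes support′ size′ value′ first′ ones′ end′ (proj₁ last′) (proj₂ last′) λ _ → extra′ e-ok
      where
      e-ok : First (λ i → p₁ < i × One B i) e
      e-ok = extra-ok (<⇒≤ 1<p)

      c : Zero B (suc p₁)
      c with B (suc p₁) in eq
      ... | false = refl
      ... | true with e-ok
      ...   | none h = contradiction (n<1+n p₁ , eq) (h (suc p₁))
      ...   | found (p<e , _) h = contradiction (n<1+n p₁ , eq) (h (suc p₁) (≤∧≢⇒< p<e (e≢q ∘ sym)))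

      open Swap D p₁ (<⇒≤ 1<p) p<n b c

      least′ : ∀ i → i < suc p₁ → ¬ AfterZero B′ i
      least′ i i<q (o , y , 1≤y , y<i , zero-y) =
        least i i<p (trans (sym (swap-below p₁ B i i<p)) o , y , 1≤y , y<i ,
                 trans (sym (swap-below p₁ B y (<-trans y<i i<p))) zero-y)
        where i<p : i < p₁
              i<p = ≤∧≢⇒< (s≤s⁻¹ i<q) λ { refl → clash o at-p }

      first′ : First (AfterZero B′) (suc p₁)
      first′ = found (at-q , z , 1≤z , m<n⇒m<1+n z<p , trans (swap-below p₁ B z z<p) zero-z) least′

      p₂<z : p₂ < z
      p₂<z = ≰⇒> λ z≤p₂ → clash (p₂-ones z 1≤z z≤p₂) zero-z

      ones′ : ∀ i → 1 ≤ i → i ≤ p₂ → One B′ i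
      ones′ i 1≤i i≤p₂ = trans (swap-below p₁ B i (≤-<-trans i≤p₂ (<-trans p₂<z z<p))) (p₂-ones i 1≤i i≤p₂)

      end′ : Zero B′ (suc p₂)
      end′ = trans (swap-below p₁ B (suc p₂) (≤-<-trans p₂<z z<p)) p₂-end

      extra′ : First (λ i → p₁ < i × One B i) e → First (λ i → suc p₁ < i × One B′ i) e
      extra′ = First-map
        (λ { i (p<i , o) → let q<i = ≤∧≢⇒< p<i λ { refl → clash o c } in
               q<i , trans (swap-above p₁ B i q<i) o })
        (λ { i (q<i , o) → <-trans (n<1+n p₁) q<i , trans (sym (swap-above p₁ B i q<i)) o })

    ruleB : 0 < p₂ → p₂ < n → Describes (swapNext p₂ B) (result m (childB r))
    ruleB 0<p p<n rewrite +-comm p₂ 1 =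
      describes support′ size′ value′ first′ ones′ end′ (proj₁ last′) (proj₂ last′) λ _ → extra′
      where
      open Swap D p₂ 0<p p<n (p₂-ones p₂ 0<p ≤-refl) p₂-end

      first′ : First (AfterZero B′) (suc p₂)
      first′ = found (at-q , p₂ , 0<p , n<1+n p₂ , at-p)
        λ { i i<q (o , y , 1≤y , y<i , zero-y) →
            let i<p = ≤∧≢⇒< (s≤s⁻¹ i<q) (λ { refl → clash o at-p })
                y<p = <-trans y<i i<p in
            clash (p₂-ones y 1≤y (<⇒≤ y<p)) (trans (sym (swap-below p₂ B y y<p)) zero-y) }

      ones′ : ∀ i → 1 ≤ i → i ≤ p₂ ∸ 1 → One B′ i
      ones′ i 1≤i i≤ = trans (swap-below p₂ B i i<p) (p₂-ones i 1≤i (<⇒≤ i<p))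
        where i<p : i < p₂
              i<p = ≤-<-trans i≤ (≤-reflexive (m+[n∸m]≡n 0<p))

      end′ : Zero B′ (suc (p₂ ∸ 1))
      end′ = subst (Zero B′) (sym (m+[n∸m]≡n 0<p)) at-p

      extra′ : First (λ i → suc p₂ < i × One B′ i) p₁
      extra′ = First-map
        (λ { i (o , y , 1≤y , y<i , zero-y) →
             let p<y = ≰⇒> λ y≤p → clash (p₂-ones y 1≤y y≤p) zero-y
                 q<i = ≤-<-trans p<y y<i in
             q<i , trans (swap-above p₂ B i q<i) o })
        (λ { i (q<i , o) → trans (sym (swap-above p₂ B i q<i)) o , suc p₂ , s≤s z≤n , q<i , p₂-end })
        p₁-ok

    ruleC : p₁ ≡ 2 → p₂ ≡ 0 → p₃ ≡ suc ls → Describes (setFirst B) (result m (childC r))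
    ruleC _ refl p₃≡ rewrite +-comm ls 1 =
      describes support′ size′ value′ (none no-first) ones′ end′ one′ last′ λ ()
      where
      open IsCommutativeRing isCommutativeRing using (+-congʳ) renaming (sym to ≈sym; trans to ≈trans)

      B′ : Pattern
      B′ = setFirst B

      p₃≤n : p₃ ≤ n
      p₃≤n = proj₂ (support p₃ p₃-one)

      p₃≥1 : 1 ≤ p₃
      p₃≥1 = proj₁ (support p₃ p₃-one)

      full : ∀ i → 2 ≤ i → i ≤ p₃ → One B i
      full (suc i) (s≤s 1≤i) i≤p₃ with B (suc i) in eq
      ... | true  = refl
      ... | false = contradiction two-zeros (≤⇒≯ (≤-reflexive (trans p₃≡ (cong suc ls≡))))
        where
        ls≡ : ls ≡ count B p₃
        ls≡ = trans size-ok (count-tail B p₃ n p₃≤n p₃-last)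
        two-zeros : 2 + count B p₃ ≤ p₃
        two-zeros = count-≤ B 2 (suc i) p₃ i≤p₃
          (count-zero B 1 i (count-≤ B 1 1 i 1≤i (count-zero B 0 0 z≤n p₂-end)) eq)

      ones′ : ∀ i → 1 ≤ i → i ≤ p₃ → One B′ i
      ones′ i 1≤i i≤p₃ with i ≟ 1
      ... | yes _  = refl
      ... | no i≢1 = full i (≤∧≢⇒< 1≤i (i≢1 ∘ sym)) i≤p₃

      last′ : ∀ i → p₃ < i → Zero B′ i
      last′ i p₃<i = trans (set-else B i (>⇒≢ (≤-<-trans p₃≥1 p₃<i))) (p₃-last i p₃<i)

      one′ : One B′ p₃
      one′ = ones′ p₃ p₃≥1 ≤-refl

      end′ : Zero B′ (suc p₃)
      end′ = last′ (suc p₃) ≤-refl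

      no-first : ∀ i → ¬ AfterZero B′ i
      no-first i (o , y , 1≤y , y<i , zero-y) with i ≤? p₃
      ... | yes i≤p₃ = clash (ones′ y 1≤y (≤-trans (<⇒≤ y<i) i≤p₃)) zero-y
      ... | no i≰p₃  = clash o (last′ i (≰⇒> i≰p₃))

      support′ : ∀ i → One B′ i → 1 ≤ i × i ≤ n
      support′ i o with i ≟ 1
      ... | yes refl = ≤-refl , ≤-trans p₃≥1 p₃≤n
      ... | no _     = support i o

      size′ : suc ls ≡ count B′ n
      size′ = trans (cong suc size-ok) (trans (+-comm 1 (count B n))
        (sym (total-add B B′ 1 n ≤-refl (≤-trans p₃≥1 p₃≤n) p₂-end (set-at B) λ i i≢1 → sym (set-else B i i≢1))))
        where open AddBit +-0-commutativeMonoid (λ _ → 1)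

      value′ : v +ᴿ R[ 1 ] ≈ sum B′ n
      value′ = ≈trans (+-congʳ value-ok)
        (≈sym (total-add B B′ 1 n ≤-refl (≤-trans p₃≥1 p₃≤n) p₂-end (set-at B) λ i i≢1 → sym (set-else B i i≢1)))
        where open AddBit +ᴿ-commutativeMonoid R[_]

{-# OPTIONS --safe #-}

-- Each iteration replaces the extracted node by at most three children, so
-- the heap never holds more than 2k + 1 < 2 ^ (2 + ⌊log₂ k⌋) nodes. Heap
-- indices halve on the way up and at least double on the way down, hence a
-- heap operation costs O(j) as long as the size stays below 2 ^ j, and the
-- remaining work of an iteration is constant.

module Submission where

open import Data.Bool using (Bool; T; true; false; not; _∧_; if_then_else_)
open import Data.List using ([]; _∷_)
open import Data.Nat
open import Data.Nat.Logarithm using (⌊log₂_⌋; ⌊log₂⌋-mono-≤; ⌊log₂[2^n]⌋≡n)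
open import Data.Nat.Properties
open import Data.Nat.Tactic.RingSolver using (solve; solve-∀)
open import Data.Product using (∃; _×_; _,_; proj₁; proj₂)
open import Data.Unit using (⊤; tt)
open import Data.Vec.Functional using (Vector)
open import Relation.Binary.PropositionalEquality
open import Relation.Nullary using (contradiction)
open import Defs

-- Powers of two

-- Otherwise monotonicity of the logarithm would give `suc ⌊log₂ n ⌋ ≤ ⌊log₂ n ⌋`.
n<2^[1+⌊log₂n⌋] : ∀ n → n < 2 ^ suc ⌊log₂ n ⌋
n<2^[1+⌊log₂n⌋] n = ≰⇒> λ 2^l≤n → 1+n≰n
  (subst (_≤ ⌊log₂ n ⌋) (⌊log₂[2^n]⌋≡n (suc ⌊log₂ n ⌋)) (⌊log₂⌋-mono-≤ 2^l≤n))

⌊n/2⌋<m : ∀ {n m} → n < 2 * m → ⌊ n /2⌋ < m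
⌊n/2⌋<m {n} {m} n<2m = *-cancelˡ-< 2 ⌊ n /2⌋ m (≤-<-trans twice≤ n<2m)
  where
  open ≤-Reasoning
  twice≤ : 2 * ⌊ n /2⌋ ≤ n
  twice≤ = begin
    2 * ⌊ n /2⌋            ≡⟨ cong (⌊ n /2⌋ +_) (+-identityʳ ⌊ n /2⌋) ⟩
    ⌊ n /2⌋ + ⌊ n /2⌋      ≤⟨ +-monoʳ-≤ ⌊ n /2⌋ (⌊n/2⌋≤⌈n/2⌉ n) ⟩
    ⌊ n /2⌋ + ⌈ n /2⌉      ≡⟨ ⌊n/2⌋+⌈n/2⌉≡n n ⟩
    n                      ∎

module Cost (𝓡 : RealField) {n : ℕ} (R : Vector (RealField.Carrier 𝓡) n) where
  open Algorithm 𝓡 R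
  open Memory using (size)

  -- Hoare logic for running time and heap size

  -- A Hoare triple that sees only the size of the heap: the bounds hold
  -- whatever the cells contain.
  record Runs {A : Set} (s : ℕ) (p : Prog A) (c : ℕ) (Q : A → ℕ → Set) : Set where
    constructor runs
    field
      time-≤  : ∀ m → size m ≡ s → time p m ≤ c
      ensures : ∀ m → size m ≡ s → Q (proj₁ (run p m)) (size (proj₂ (run p m)))

  open Runs

  Keeps : {A : Set} → ℕ → Prog A → ℕ → Set
  Keeps s p c = Runs s p c λ _ s′ → s′ ≡ s

  private
    variable
      A B : Set
      s c d : ℕ
      Q Q′ : A → ℕ → Set
      p : Prog A
      f : A → Prog B
      instr : Instr A

  -- The bound `c` is free, so an early exit can be charged the budget of a longer branch.
  finish : ∀ {a : A} → Q a s → Runs s (return a) c Q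
  finish {Q = Q} {a = a} q = runs (λ _ _ → z≤n) λ _ eq → subst (Q a) (sym eq) q

  weaken : c ≤ d → (∀ a s′ → Q a s′ → Q′ a s′) → Runs s p c Q → Runs s p d Q′
  weaken c≤d g r = runs (λ m eq → ≤-trans (time-≤ r m eq) c≤d)
                        (λ m eq → g _ _ (ensures r m eq))

  atMost : c ≤ d → Runs s p c Q → Runs s p d Q
  atMost c≤d = weaken c≤d λ _ _ q → q

  bind : Runs s p c Q → (∀ a s′ → Q a s′ → Runs s′ (f a) d Q′) →
         Runs s (p >>= f) (c + d) Q′
  bind r g = runs
    (λ m eq → +-mono-≤ (time-≤ r m eq) (time-≤ (g _ _ (ensures r m eq)) _ refl))
    (λ m eq → ensures (g _ _ (ensures r m eq)) _ refl)

  keep : Keeps s p c → (∀ a → Runs s (f a) d Q) → Runs s (p >>= f) (c + d) Q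
  keep r g = bind r λ { a _ refl → g a }

  -- A trailing `return` costs nothing; going through `bind` would leave an extra summand in the
  -- bound.
  mapResult : ∀ {g : A → B} → Runs s p c Q → (∀ a s′ → Q a s′ → Q′ (g a) s′) →
              Runs s (p >>= λ a → return (g a)) c Q′
  mapResult r h = runs
    (λ m eq → subst (_≤ _) (sym (+-identityʳ _)) (time-≤ r m eq))
    (λ m eq → h _ _ (ensures r m eq))

  pure : ∀ {a} → (∀ m → exec instr m ≡ (a , m)) →
         Runs s (f a) c Q → Runs s (⟪ instr ⟫ >>= f) (suc c) Q
  pure {s = s} {f = f} {c = c} {Q = Q} h r = runs
    (λ m eq → s≤s (subst (λ (a , m′) → time (f a) m′ ≤ c) (sym (h m)) (time-≤ r m eq)))
    (λ m eq → subst (λ (a , m′) → Q (proj₁ (run (f a) m′)) (size (proj₂ (run (f a) m′))))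
                    (sym (h m)) (ensures r m eq))

  add : ∀ {i j} → Runs s (f (i + j)) c Q → Runs s (⟪ addℕ i j ⟫ >>= f) (suc c) Q
  add = pure λ _ → refl

  sub : ∀ {i j} → Runs s (f (i ∸ j)) c Q → Runs s (⟪ subℕ i j ⟫ >>= f) (suc c) Q
  sub = pure λ _ → refl

  mul : ∀ {i j} → Runs s (f (i * j)) c Q → Runs s (⟪ mulℕ i j ⟫ >>= f) (suc c) Q
  mul = pure λ _ → refl

  half : ∀ {i} → Runs s (f ⌊ i /2⌋) c Q → Runs s (⟪ halfℕ i ⟫ >>= f) (suc c) Q
  half = pure λ _ → refl

  getS : Runs s (f s) c Q → Runs s (⟪ getSize ⟫ >>= f) (suc c) Q
  getS r = runs (λ { m refl → s≤s (time-≤ r m refl) }) λ { m refl → ensures r m refl }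

  setS : ∀ {t} → Runs t (f tt) c Q → Runs s (⟪ setSize t ⟫ >>= f) (suc c) Q
  setS r = runs (λ _ _ → s≤s (time-≤ r _ refl)) λ _ _ → ensures r _ refl

  -- For instructions whose result does not affect the bound: reads, cell writes, output and tests
  -- with both outcomes allowed.
  any : (∀ m → size (proj₂ (exec instr m)) ≡ size m) →
        (∀ a → Runs s (f a) c Q) → Runs s (⟪ instr ⟫ >>= f) (suc c) Q
  any h g = runs (λ m eq → s≤s (time-≤ (g _) _ (trans (h m) eq)))
                 λ m eq → ensures (g _) _ (trans (h m) eq)

  -- Each branch receives the outcome as an inequality, which the index arguments below rely on.
  leq : ∀ i j → (i ≤ j → Runs s (f true) c Q) → (j < i → Runs s (f false) c Q) →
        Runs s (⟪ leqℕ i j ⟫ >>= f) (suc c) Q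
  leq i j yes no with i ≤ᵇ j in eq
  ... | true  = pure (λ m → cong (_, m) eq) (yes (≤ᵇ⇒≤ i j (subst T (sym eq) tt)))
  ... | false = pure (λ m → cong (_, m) eq) (no (≰⇒> λ i≤j → subst T eq (≤⇒≤ᵇ i≤j)))

  cond : ∀ b {q : Prog A} → Runs s p c Q → Runs s q c Q → Runs s (if b then p else q) c Q
  cond true  r _ = r
  cond false _ r = r

  -- Heap operations

  swapCells-runs : ∀ i j → Keeps s (swapCells i j) 4
  swapCells-runs i j = runs (λ _ _ → ≤-refl) λ _ eq → eq

  before-runs : ∀ o i j → Keeps s (before o i j) 3
  before-runs min i j = runs (λ _ _ → ≤-refl) λ _ eq → eq
  before-runs max i j = before-runs min j i

  -- Induction on the exponent `j`, which drops with each halving of `i`; the bound is thus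
  -- independent of the fuel. A level costs one comparison and one halving.
  levelOrder-runs : ∀ j f i → i < 2 ^ j → Keeps s (levelOrder f i) (suc j * 2)
  levelOrder-runs j       zero    i i<   = finish refl
  levelOrder-runs zero    (suc f) i i<   = leq i 1 (λ _ → finish refl)
    λ 1<i → contradiction i< (<⇒≯ 1<i)
  levelOrder-runs (suc j) (suc f) i i<   = leq i 1 (λ _ → finish refl) λ _ →
    half (mapResult (levelOrder-runs j f ⌊ i /2⌋ (⌊n/2⌋<m i<)) λ _ _ eq → eq)

  -- A step halves the index twice, of which one halving pays for the descent in `j`. Its cost is 1
  -- + 2 + 3 + 4: test, halvings, comparison, swap.
  bubbleUpGrand-runs : ∀ o j f i → i < 2 ^ j → Keeps s (bubbleUpGrand o f i) (suc j * 10)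
  bubbleUpGrand-runs o j       zero    i i< = finish refl
  bubbleUpGrand-runs o zero    (suc f) i i< = leq 4 i
    (λ 4≤i → contradiction (≤-trans i< (s≤s z≤n)) (≤⇒≯ 4≤i)) λ _ → finish refl
  bubbleUpGrand-runs o (suc j) (suc f) i i< = leq 4 i
    (λ _ → half (half (keep (before-runs o i _) λ
      { false → finish refl
      ; true  → keep (swapCells-runs i _) λ _ →
          bubbleUpGrand-runs o j f _ (≤-<-trans (⌊n/2⌋≤n ⌊ i /2⌋) (⌊n/2⌋<m i<)) })))
    λ _ → finish refl

  bubbleUp-runs : ∀ j i → i < 2 ^ j → Keeps s (bubbleUp i) (suc j * 2 + (9 + suc j * 10))
  bubbleUp-runs j i i< = keep (levelOrder-runs j i i i<) λ o → leq 2 i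
    (λ _ → half (keep (before-runs o _ i) λ
      { true  → keep (swapCells-runs i _) λ _ →
          bubbleUpGrand-runs _ j i _ (≤-<-trans (⌊n/2⌋≤n i) i<)
      -- The 4 is the swap made only in the other branch.
      ; false → atMost (m≤n+m _ 4) (bubbleUpGrand-runs o j i i i<) }))
    λ _ → finish refl

  -- `P` carries a property of both candidates to the winner; `removeMax` uses it to know that its
  -- index is positive.
  better-runs : ∀ {P : ℕ → Set} o i j → P i → P j →
                Runs s (better o i j) 5 λ a s′ → s′ ≡ s × P a
  better-runs {s} o i j Pi Pj = getS (leq j s
    (λ _ → mapResult (before-runs o j i) λ
      { true _ eq → eq , Pj ; false _ eq → eq , Pi })
    λ _ → finish (refl , Pi))

  better-keeps : ∀ o i j → Keeps s (better o i j) 5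
  better-keeps o i j = weaken ≤-refl (λ _ _ → proj₁)
    (better-runs {P = λ _ → ⊤} o i j tt tt)

  bestDescendant-runs : ∀ o i → Keeps s (bestDescendant o i) 31
  bestDescendant-runs o i = mul (add (mul (add (add (add
    (keep (better-keeps o _ _) λ _ →
     keep (better-keeps o _ _) λ _ →
     keep (better-keeps o _ _) λ _ →
     keep (better-keeps o _ _) λ _ →
     better-keeps o _ _))))))

  -- Here `d` bounds how often `i` can double before it exceeds `s`. At `d = 0` already `s < i`, so
  -- there is no child. The 51 is one full step, 31 of it for `bestDescendant`.
  trickleDown-runs : ∀ o d f i → s < i * 2 ^ d → Keeps s (trickleDown o f i) (suc d * 51)
  trickleDown-runs o d zero i s< = finish refl
  trickleDown-runs {s} o zero (suc f) i s< = getS (mul (leq (2 * i) s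
    (λ 2i≤s → contradiction (≤-trans (m≤m+n i _) 2i≤s)
                (<⇒≱ (subst (s <_) (*-identityʳ i) s<)))
    λ _ → finish refl))
  trickleDown-runs {s} o (suc d) (suc f) i s< = getS (mul (leq (2 * i) s
    (λ _ → keep (bestDescendant-runs o i) λ b → keep (before-runs o b i) λ
      { false → finish refl
      ; true  → keep (swapCells-runs i b) λ _ → mul (leq (4 * i) b
          -- The program's own test supplies `4 * i ≤ b`, so the growth of the index follows without
          -- analysing what `bestDescendant` returns.
          (λ 4i≤b → half (keep (before-runs o _ b) λ b′ →
             keep (cond b′ (swapCells-runs b _) (finish refl)) λ _ →
             trickleDown-runs o d f b (descend 4i≤b)))
          λ _ → finish refl) })
    λ _ → finish refl))
    where
    open ≤-Reasoning
    descend : ∀ {b} → 4 * i ≤ b → s < b * 2 ^ d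
    descend {b} 4i≤b = begin-strict
      s                <⟨ s< ⟩
      i * (2 * 2 ^ d)  ≡⟨ *-assoc i 2 (2 ^ d) ⟨
      i * 2 * 2 ^ d    ≡⟨ cong (_* 2 ^ d) (*-comm i 2) ⟩
      2 * i * 2 ^ d    ≤⟨ *-monoˡ-≤ (2 ^ d) (≤-trans (*-monoˡ-≤ i (m≤m+n 2 2)) 4i≤b) ⟩
      b * 2 ^ d        ∎

  -- The new node starts in cell `s + 1`, hence `suc s < 2 ^ j`. The 25 is 4 + 2 + 9 + 10, the cost
  -- at `j = 0`, and exceeds the slope 12.
  insert-runs : ∀ j e → suc s < 2 ^ j →
                Runs s (insert e) (suc j * 25) λ _ s′ → s′ ≡ suc s
  insert-runs {s} j e s< = atMost cost (getS (add (setS (any (λ _ → refl) λ _ →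
    weaken ≤-refl (λ { _ _ refl → +-comm s 1 })
      (bubbleUp-runs j (s + 1) (subst (_< 2 ^ j) (+-comm 1 s) s<))))))
    where
    open ≤-Reasoning
    cost : 4 + (suc j * 2 + (9 + suc j * 10)) ≤ suc j * 25
    cost = begin
      4 + (suc j * 2 + (9 + suc j * 10))  ≡⟨ (solve (j ∷ [])) ⟩
      25 + j * 12                         ≤⟨ +-monoʳ-≤ 25 (*-monoʳ-≤ j (m≤m+n 12 13)) ⟩
      suc j * 25                          ∎

  removeAt-runs : ∀ o j i → 1 ≤ i → s < 2 ^ j →
                  Runs s (removeAt o i) (6 + suc j * 51) λ _ s′ → s′ ≡ s ∸ 1
  removeAt-runs {s} o j i 1≤i s< = getS (any (λ _ → refl) λ _ →
    any (λ _ → refl) λ _ → any (λ _ → refl) λ _ → sub (setS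
      (mapResult (trickleDown-runs o j (s ∸ 1) i s-1<) λ _ _ eq → eq)))
    where
    s-1< : s ∸ 1 < i * 2 ^ j
    s-1< = ≤-<-trans (m∸n≤m s 1)
      (<-≤-trans s< (m≤n*m (2 ^ j) i {{>-nonZero 1≤i}}))

  removeMax-runs : ∀ j → s < 2 ^ j →
                   Runs s removeMax (13 + suc j * 51) λ _ s′ → s′ ≡ s ∸ 1
  removeMax-runs {s} j s< = getS (leq s 1
    (λ _ → atMost (m≤n+m _ 5) (removeAt-runs min j 1 ≤-refl s<))
    λ _ → bind (better-runs {P = 1 ≤_} max 2 3 (s≤s z≤n) (s≤s z≤n)) λ
      { i _ (refl , 1≤i) → removeAt-runs max j i 1≤i s< })

  -- Children and iterations

  childA-runs : ∀ r → Keeps s (childA r) 6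
  childA-runs r = runs (λ _ _ → ≤-refl) λ _ eq → eq

  childB-runs : ∀ r → Keeps s (childB r) 7
  childB-runs r = runs (λ _ _ → ≤-refl) λ _ eq → eq

  childC-runs : ∀ r → Keeps s (childC r) 3
  childC-runs r = runs (λ _ _ → ≤-refl) λ _ eq → eq

  -- An inequality, because the analysis leaves open whether the rule fires.
  Grows : ℕ → ⊤ → ℕ → Set
  Grows s _ s′ = s′ ≤ suc s

  insertChild : ∀ j e → suc s < 2 ^ j → Runs s (insert e) (suc j * 25) (Grows s)
  insertChild j e s< = weaken ≤-refl (λ _ _ → ≤-reflexive) (insert-runs j e s<)

  tryA-runs : ∀ j q r → suc s < 2 ^ j → Runs s (tryA q r) (10 + suc j * 25) (Grows s)
  tryA-runs j q r s< = any (λ _ → refl) λ b₁ → add (any (λ _ → refl) λ b₂ →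
    any (λ _ → refl) λ b₃ → cond (b₁ ∧ b₂ ∧ not b₃)
      (keep (childA-runs r) λ _ → insertChild j _ s<)
      (finish (n≤1+n _)))

  tryB-runs : ∀ j q r → suc s < 2 ^ j → Runs s (tryB q r) (10 + suc j * 25) (Grows s)
  tryB-runs j q r s< = any (λ _ → refl) λ b₁ → add (any (λ _ → refl) λ b₂ →
    cond (b₁ ∧ b₂)
      (keep (childB-runs r) λ _ → insertChild j _ s<)
      (finish (n≤1+n _)))

  tryC-runs : ∀ j q r → suc s < 2 ^ j → Runs s (tryC q r) (7 + suc j * 25) (Grows s)
  tryC-runs j q r s< = any (λ _ → refl) λ b₁ → any (λ _ → refl) λ b₂ → add
    (any (λ _ → refl) λ b₃ → cond (b₁ ∧ b₂ ∧ b₃)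
      (keep (childC-runs r) λ _ → insertChild j _ s<)
      (finish (n≤1+n _)))

  -- The 177 is 51 + 3 * 25 + 51: extraction, three insertions, removal of the maximum. The 53
  -- collects the constant costs.
  iteration : ℕ → ℕ
  iteration J = 53 + J * 177

  -- The invariant `s + t * 2 < 2 ^ j` survives because an iteration adds at most 3 - 1 = 2 nodes
  -- while `t` drops by one.
  loop-runs : ∀ j t q k → s + t * 2 < 2 ^ j →
              Runs s (loop t q k) (t * iteration (suc j)) λ _ _ → ⊤
  loop-runs j zero q k s< = finish tt
  loop-runs {zero} j (suc t) q k s< = getS (pure (λ _ → refl) (finish tt))
  loop-runs {suc s} j (suc t) q k s< = atMost (≤-reflexive (regroup (suc j) _))
    (getS (pure (λ _ → refl)
      (bind (removeAt-runs min j 1 ≤-refl (≤-<-trans (m≤m+n (suc s) _) s<)) λ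
        { (r , _) _ refl → any (λ _ → refl) λ _ →
      bind (tryA-runs j q r (bound 1 (s≤s z≤n) ≤-refl)) λ _ s₁ h₁ →
      bind (tryB-runs j q r (bound 2 (s≤s (s≤s z≤n)) (s≤s h₁))) λ _ s₂ h₂ →
      bind (tryC-runs j q r (bound 3 ≤-refl (s≤s (≤-trans h₂ (s≤s h₁))))) λ _ s₃ h₃ →
      let h = ≤-trans h₃ (s≤s (≤-trans h₂ (s≤s h₁)))
          s₃< = bound 3 ≤-refl h
          next : ∀ s′ → s′ ≤ s₃ → s′ + t * 2 < 2 ^ j
          next s′ s′≤s₃ = ≤-<-trans (+-monoˡ-≤ (t * 2) (≤-trans s′≤s₃ h)) room
      in getS (sub (leq s₃ (k ∸ q)
           -- Padding to the cost of `removeMax`, so that both branches have the same bound.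
           (λ _ → keep {c = 13 + suc j * 51} (finish refl) λ _ →
             add (loop-runs j t _ k (next s₃ ≤-refl)))
           λ _ → bind {c = 13 + suc j * 51} (mapResult (removeMax-runs j s₃<) λ _ _ eq → eq) λ
             { _ _ refl → add (loop-runs j t _ k (next (s₃ ∸ 1) (m∸n≤m s₃ 1))) })) })))
    where
    shift-2 : ∀ s t → suc s + suc t * 2 ≡ 3 + s + t * 2
    shift-2 = solve-∀

    room : 3 + s + t * 2 < 2 ^ j
    room = subst (_< 2 ^ j) (shift-2 s t) s<

    -- After the extraction `s` nodes remain; `i` counts the insertions allowed for since then.
    bound : ∀ i {x} → i ≤ 3 → x ≤ i + s → x < 2 ^ j
    bound i i≤3 x≤ = ≤-<-trans (≤-trans x≤
      (≤-trans (+-monoˡ-≤ s i≤3) (m≤m+n (3 + s) (t * 2)))) room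

    regroup : ∀ J x → 2 + (6 + J * 51 + (1 + (10 + J * 25 + (10 + J * 25 + (7 + J * 25 +
                (2 + (1 + (13 + J * 51 + (1 + x))))))))) ≡ 53 + J * 177 + x
    regroup = solve-∀

  iteration-≤ : ∀ j → iteration (suc j) ≤ 230 * suc j
  iteration-≤ j = begin
    230 + j * 177                    ≤⟨ +-monoʳ-≤ 230 (*-monoʳ-≤ j (m≤m+n 177 53)) ⟩
    230 + j * 230                    ≡⟨ *-comm (suc j) 230 ⟩
    230 * suc j                      ∎
    where
    open ≤-Reasoning

  modifiedAlgorithm2-runs : ∀ j k → suc (k * 2) < 2 ^ j →
    Runs 0 (modifiedAlgorithm2 k) (1 + (suc j * 25 + k * iteration (suc j))) λ _ _ → ⊤
  modifiedAlgorithm2-runs j k k< = any (λ _ → refl) λ _ →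
    bind (insert-runs j _ (≤-trans (s≤s (s≤s z≤n)) k<)) λ { _ _ refl → loop-runs j k 1 k k< }

  -- The 230 is 53 + 177, and 26 covers the initial fetch and insertion, absorbed into the main term
  -- by `1 ≤ k`.
  runningTime-≤ : ∀ j k → 1 ≤ k → suc (k * 2) < 2 ^ j → runningTime k ≤ 256 * (k * suc j)
  runningTime-≤ j k 1≤k k< = begin
    runningTime k
      ≤⟨ Runs.time-≤ (modifiedAlgorithm2-runs j k k<) initial refl ⟩
    1 + (suc j * 25 + k * iteration (suc j))
      ≤⟨ +-mono-≤ {1} {suc j} (s≤s z≤n)
           (+-monoʳ-≤ (suc j * 25) (*-monoʳ-≤ k (iteration-≤ j))) ⟩
    suc j + (suc j * 25 + k * (230 * suc j))
      ≡⟨ collect (suc j) k ⟩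
    26 * suc j + 230 * (k * suc j)
      ≤⟨ +-monoˡ-≤ (230 * (k * suc j))
           (*-monoʳ-≤ 26 (m≤n*m (suc j) k {{>-nonZero 1≤k}})) ⟩
    26 * (k * suc j) + 230 * (k * suc j)
      ≡⟨ *-distribʳ-+ (k * suc j) 26 230 ⟨
    256 * (k * suc j)
      ∎
    where
    open ≤-Reasoning
    collect : ∀ J k → J + (J * 25 + k * (230 * J)) ≡ 26 * J + 230 * (k * J)
    collect = solve-∀

-- Passage to the asymptotic bound

-- The maximum with 1 is for `k = 1`, where the logarithm vanishes; from 2 on the logarithm is at
-- least 1.
k≤1⊔k*⌊log₂k⌋ : ∀ k → k ≤ 1 ⊔ k * ⌊log₂ k ⌋
k≤1⊔k*⌊log₂k⌋ zero            = z≤n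
k≤1⊔k*⌊log₂k⌋ (suc zero)      = ≤-refl
k≤1⊔k*⌊log₂k⌋ k@(suc (suc _)) =
  ≤-trans (m≤m*n k ⌊log₂ k ⌋) (m≤n⊔m 1 _)

k*[3+⌊log₂k⌋]≤ : ∀ k → k * (3 + ⌊log₂ k ⌋) ≤ 4 * (1 ⊔ k * ⌊log₂ k ⌋)
k*[3+⌊log₂k⌋]≤ k = begin
  k * (3 + l)        ≡⟨ expand k l ⟩
  k * l + 3 * k      ≤⟨ +-mono-≤ (m≤n⊔m 1 (k * l)) (*-monoʳ-≤ 3 (k≤1⊔k*⌊log₂k⌋ k)) ⟩
  4 * (1 ⊔ k * l)    ∎
  where
  open ≤-Reasoning
  l = ⌊log₂ k ⌋
  expand : ∀ k l → k * (3 + l) ≡ k * l + 3 * k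
  expand = solve-∀

-- Twice `suc k ≤ 2 ^ suc ⌊log₂ k ⌋`. The left side is the loop invariant at the start: one node and
-- `k` iterations to go.
1+2k<2^[2+⌊log₂k⌋] : ∀ k → suc (k * 2) < 2 ^ (2 + ⌊log₂ k ⌋)
1+2k<2^[2+⌊log₂k⌋] k =
  subst (suc k * 2 ≤_) (*-comm (2 ^ suc ⌊log₂ k ⌋) 2) (*-monoˡ-≤ 2 (n<2^[1+⌊log₂n⌋] k))

lemma3p12 : ∃ λ c → (𝓡 : RealField) (n : ℕ) → 1 ≤ n →
    (R : Vector (RealField.Carrier 𝓡) n) → Sorted 𝓡 R →
    (k : ℕ) → 1 ≤ k →
    Algorithm.runningTime 𝓡 R k ≤ c * (1 ⊔ k * ⌊log₂ k ⌋)
lemma3p12 = 256 * 4 , λ 𝓡 n _ R _ k 1≤k →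
  ≤-trans (Cost.runningTime-≤ 𝓡 R (2 + ⌊log₂ k ⌋) k 1≤k (1+2k<2^[2+⌊log₂k⌋] k))
    (≤-trans (*-monoʳ-≤ 256 (k*[3+⌊log₂k⌋]≤ k))
      (≤-reflexive (sym (*-assoc 256 4 (1 ⊔ k * ⌊log₂ k ⌋)))))
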